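{- Let $\theta=(\alpha,\beta,\gamma)\in S_n\times S_n\times S_n$. If $\theta\in\mathrm{Atp}(n)$ then $\mathrm{per}(X_s)>0$ for all $s\in[n]$.
   Context: A Latin square of order $n$ is an $n\times n$ array $L=L(i,j)$ with rows, columns and symbols indexed by $[n]=\{1,\dots,n\}$ such that the symbols in every row and in every column are distinct. A triple $(\alpha,\beta,\gamma)\in S_n\times S_n\times S_n$ is an autotopism of $L$ if $\gamma(L(i,j))=L(\alpha(i),\beta(j))$ for all $i,j\in[n]$. $\mathrm{Atp}(n)$ is the set of all triples that are an autotopism of at least one Latin square of order $n$. For $\theta=(\alpha,\beta,\gamma)$ and $s\in[n]$, let $c$ be the length of the cycle of $\gamma$ containing $s$. The $n\times n$ $(0,1)$-matrix $X_s$ is defined by $X_s(i,j)=1$ if $i$ belongs to an $a$-cycle of $\alpha$ and $j$ belongs to a $b$-cycle of $\beta$ such that $\mathrm{lcm}(a,b)=\mathrm{lcm}(b,c)=\mathrm{lcm}(a,c)=\mathrm{lcm}(a,b,c)$, and $X_s(i,j)=0$ otherwise (fixed points are cycles of length $1$). The permanent of an $n\times n$ matrix $X$ is $\mathrm{per}(X)=\sum_{\sigma\in S_n}\prod_{i\in[n]}X(i,\sigma(i))$. -}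

module Defs where

open import Data.Bool.Base using (if_then_else_)
open import Data.Fin.Base using (Fin; zero; suc; toℕ; punchIn)
open import Data.Fin.Permutation using (Permutation′; _⟨$⟩ʳ_; _≈_; id; insert; remove; insert-punchIn; insert-remove)
open import Data.Fin.Properties as Fin using (pigeonhole; punchIn-injective)
open import Data.List.Base using (List; []; _∷_; map; tabulate; allFin; cartesianProductWith)
open import Data.List.Membership.Propositional.Properties using (∈-allFin)
import Data.List.Membership.Setoid as Membership
import Data.List.Relation.Unary.All as All
import Data.List.Relation.Unary.AllPairs as AllPairs
open import Data.List.Relation.Unary.Any using (here)
open import Data.List.Relation.Unary.Any.Properties using (cartesianProductWith⁺)
import Data.List.Relation.Unary.Unique.Setoid as Uniqueness
import Data.List.Relation.Unary.Unique.Setoid.Properties as Unique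
open import Data.List.Relation.Unary.Unique.Propositional.Properties using (allFin⁺)
open import Data.Nat.Base using (ℕ; zero; suc; _<_; z<s; s<s⁻¹)
open import Data.Nat.GeneralisedArithmetic using (fold)
open import Data.Nat.LCM using (lcm)
open import Data.Nat.ListAction using (sum; product)
open import Data.Nat.Properties using (_≟_; n<1+n)
open import Data.Product.Base using (∃; _×_; _,_; proj₁)
open import Function.Base using (_∘_)
open import Function.Bundles using (Injection)
open import Function.Definitions using (Injective)
open import Function.Properties.Inverse using (↔⇒↣)
open import Level using (0ℓ)
open import Relation.Binary.Bundles using (Setoid)
open import Relation.Binary.PropositionalEquality using (_≡_; _≢_; refl; sym; trans; cong; setoid)
open import Relation.Nullary using (¬_; Dec; yes; no; does)
open import Relation.Nullary.Decidable using (_×-dec_)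
open import Relation.Unary using (Pred; Decidable)

private
  variable
    n : ℕ

-- The index set {1,…,n} is rendered as Fin n = {0,…,n-1}.

Square : ℕ → Set
Square n = Fin n → Fin n → Fin n

record IsLatinSquare (L : Square n) : Set where
  field
    row-distinct    : ∀ i → Injective _≡_ _≡_ (λ j → L i j)
    column-distinct : ∀ j → Injective _≡_ _≡_ (λ i → L i j)

Triple : ℕ → Set
Triple n = Permutation′ n × Permutation′ n × Permutation′ n

IsAutotopism : Square n → Triple n → Set
IsAutotopism L (α , β , γ) =
  ∀ i j → γ ⟨$⟩ʳ L i j ≡ L (α ⟨$⟩ʳ i) (β ⟨$⟩ʳ j)

Atp : ∀ n → Pred (Triple n) 0ℓ
Atp n θ = ∃ λ (L : Square n) → IsLatinSquare L × IsAutotopism L θ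

-- The cycle of π through i is (i, π i, …, πᵏ⁻¹ i) for the least k ≥ 1 with
-- πᵏ i = i, and this k is its length; here πᵐ i is fold i (π ⟨$⟩ʳ_) m.
record IsCycleLength (π : Permutation′ n) (i : Fin n) (k : ℕ) : Set where
  field
    positive : 0 < k
    returns  : fold i (π ⟨$⟩ʳ_) k ≡ i
    minimal  : ∀ {m} → 0 < m → m < k → fold i (π ⟨$⟩ʳ_) m ≢ i

private
  least : {P : Pred ℕ 0ℓ} → Decidable P → ∀ m → P m →
          ∃ λ k → P k × (∀ {j} → j < k → ¬ P j)
  least P? m pm with P? zero
  least P? m       pm | yes p0 = zero , p0 , λ ()
  least P? zero    pm | no ¬p0 = zero , pm , λ ()
  least {P} P? (suc m) pm | no ¬p0
    with k , pk , below ← least (P? ∘ suc) m pm = suc k , pk , below′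
    where
    below′ : ∀ {j} → j < suc k → ¬ P j
    below′ {zero}  _   = ¬p0
    below′ {suc j} j<k = below (s<s⁻¹ j<k)

  unwind : ∀ (π : Permutation′ n) i {a b} → a < b →
           fold i (π ⟨$⟩ʳ_) a ≡ fold i (π ⟨$⟩ʳ_) b →
           ∃ λ d → fold i (π ⟨$⟩ʳ_) (suc d) ≡ i
  unwind π i {zero}  {suc b} _   eq = b , sym eq
  unwind π i {suc a} {suc b} a<b eq =
    unwind π i (s<s⁻¹ a<b) (Injection.injective (↔⇒↣ π) eq)

cycle-length : ∀ (π : Permutation′ n) i → ∃ (IsCycleLength π i)
cycle-length {n} π i
  with _ , _ , a<b , eq ← pigeonhole (n<1+n n) (λ k → fold i (π ⟨$⟩ʳ_) (toℕ k))
  with d , ret ← unwind π i a<b eq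
  with k , ret′ , below ← least (λ m → fold i (π ⟨$⟩ʳ_) (suc m) Fin.≟ i) d ret
  = suc k , record
    { positive = z<s
    ; returns  = ret′
    ; minimal  = λ { {suc m} _ m<k → below (s<s⁻¹ m<k) }
    }

cycleLength : Permutation′ n → Fin n → ℕ
cycleLength π i = proj₁ (cycle-length π i)

Matrix : ℕ → Set
Matrix n = Fin n → Fin n → ℕ

LcmCondition : ℕ → ℕ → ℕ → Set
LcmCondition a b c =
  lcm a b ≡ lcm b c × lcm b c ≡ lcm a c × lcm a c ≡ lcm (lcm a b) c

lcmCondition? : ∀ a b c → Dec (LcmCondition a b c)
lcmCondition? a b c =
  lcm a b ≟ lcm b c ×-dec lcm b c ≟ lcm a c ×-dec lcm a c ≟ lcm (lcm a b) c

X : Triple n → Fin n → Matrix n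
X (α , β , γ) s i j =
  if does (lcmCondition? (cycleLength α i) (cycleLength β j) (cycleLength γ s))
  then 1 else 0

-- A permutation of Fin (suc n) is determined by the image of zero and by the
-- permutation of Fin n left after deleting zero and its image.
permutations : ∀ n → List (Permutation′ n)
permutations zero    = id ∷ []
permutations (suc n) =
  cartesianProductWith (insert zero) (allFin (suc n)) (permutations n)

permutationSetoid : ℕ → Setoid 0ℓ 0ℓ
permutationSetoid n = record
  { Carrier       = Permutation′ n
  ; _≈_           = _≈_
  ; isEquivalence = record
    { refl  = λ _ → refl
    ; sym   = λ π≈ρ i → sym (π≈ρ i)
    ; trans = λ π≈ρ ρ≈σ i → trans (π≈ρ i) (ρ≈σ i)
    }
  }

private
  insert-injective : ∀ {j k} {π ρ : Permutation′ n} →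
                     insert zero j π ≈ insert zero k ρ → j ≡ k × π ≈ ρ
  insert-injective {j = j} {π = π} {ρ} eq with refl ← eq zero =
    refl , λ i → punchIn-injective j _ _
      (trans (sym (insert-punchIn zero j π i))
        (trans (eq (suc i)) (insert-punchIn zero j ρ i)))

  insert-cong : ∀ j {π ρ : Permutation′ n} → π ≈ ρ →
                insert zero j π ≈ insert zero j ρ
  insert-cong j         π≈ρ zero    = refl
  insert-cong j {π} {ρ} π≈ρ (suc i) =
    trans (insert-punchIn zero j π i)
      (trans (cong (punchIn j) (π≈ρ i)) (sym (insert-punchIn zero j ρ i)))

permutations-complete : ∀ (π : Permutation′ n) →
  let open Membership (permutationSetoid n) in π ∈ permutations n
permutations-complete {zero}  π = here λ ()
permutations-complete {suc n} π =
  cartesianProductWith⁺ (insert zero)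
    (λ { refl rem≈ρ i → trans (sym (insert-remove zero π i)) (insert-cong (π ⟨$⟩ʳ zero) rem≈ρ i) })
    (∈-allFin (π ⟨$⟩ʳ zero)) (permutations-complete (remove zero π))

permutations-unique : ∀ n →
  let open Uniqueness (permutationSetoid n) in Unique (permutations n)
permutations-unique zero    = All.[] AllPairs.∷ AllPairs.[]
permutations-unique (suc n) =
  Unique.cartesianProductWith⁺
    (setoid (Fin (suc n))) (permutationSetoid n) (permutationSetoid (suc n))
    (insert zero) insert-injective (allFin⁺ (suc n)) (permutations-unique n)

per : Matrix n → ℕ
per {n} M = sum (map (λ σ → product (tabulate (λ i → M i (σ ⟨$⟩ʳ i)))) (permutations n))

{-# OPTIONS --safe #-}
-- The cells of a Latin square L containing the symbol s form a permutation
-- i ↦ j with L(i,j) = s.  By the autotopism, any two of αᵐ i = i, βᵐ j = j and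
-- γᵐ s = s imply the third, so each of the three cycle lengths divides the lcm
-- of the other two.  Hence this permutation contributes 1 to per(X_s).

module Submission where

open import Data.Bool.Base using (if_then_else_)
open import Data.Fin.Base using (punchOut)
open import Data.Fin.Permutation using (Permutation′; _⟨$⟩ʳ_; _≈_; permutation)
open import Data.Fin.Properties using (_≟_; any?; injective⇒≤; punchOut-injective)
open import Data.List.Base using (_∷_; map; tabulate)
open import Data.List.Relation.Unary.All.Properties using (tabulate⁺)
open import Data.List.Relation.Unary.Any as Any using (Any; here; there)
open import Data.Nat.Base using (zero; suc; _+_; _*_; NonZero; >-nonZero; >-nonZero⁻¹)
open import Data.Nat.Divisibility using (_∣_; divides-refl; m%n≡0⇒n∣m; ∣-trans; ∣-antisym)
open import Data.Nat.DivMod using (_/_; _%_; m%n<n; m≡m%n+[m/n]*n)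
open import Data.Nat.GeneralisedArithmetic using (fold; fold-+)
open import Data.Nat.LCM using (lcm; m∣lcm[m,n]; n∣lcm[m,n]; lcm-least)
open import Data.Nat.ListAction using (sum; product)
open import Data.Nat.ListAction.Properties using (product≢0)
open import Data.Nat.Properties as ℕ using (<-≤-trans; m≤m+n; m≤n+m; n≢0⇒n>0; 1+n≰n)
open import Data.Product.Base using (_,_; proj₁; proj₂)
open import Function.Base using (_∘_)
open import Function.Definitions using (Injective; StrictlySurjective)
open import Relation.Binary.PropositionalEquality
  using (_≡_; _≢_; refl; sym; trans; cong; cong₂; subst; module ≡-Reasoning)
open import Relation.Nullary using (yes; no; does; contradiction)
open import Relation.Nullary.Decidable using (dec-true; decidable-stable)

open import Data.Nat.Base using (ℕ; _<_)
open import Data.Fin.Base using (Fin)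
open import Defs

private
  variable
    n : ℕ

-- Pigeonhole: if `y` were missed, punching `y` out of every value would inject `Fin (suc n)` into
-- `Fin n`.
injective⇒surjective : {f : Fin n → Fin n} → Injective _≡_ _≡_ f → StrictlySurjective _≡_ f
injective⇒surjective {suc n} {f} inj y with any? (λ x → f x ≟ y)
... | yes hit  = hit
... | no  miss = contradiction (injective⇒≤ {f = λ x → punchOut (avoids x)} inj′) 1+n≰n
  where
  avoids : ∀ x → y ≢ f x
  avoids x y≡fx = miss (x , sym y≡fx)

  inj′ : Injective _≡_ _≡_ (λ x → punchOut (avoids x))
  inj′ eq = inj (punchOut-injective (avoids _) (avoids _) eq)

injective⇒permutation : (f : Fin n → Fin n) → Injective _≡_ _≡_ f → Permutation′ n
injective⇒permutation f inj =
  permutation f (proj₁ ∘ surj) (proj₂ ∘ surj) (λ x → inj (proj₂ (surj (f x))))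
  where surj = injective⇒surjective inj

sum-positive : ∀ {A : Set} (f : A → ℕ) {xs} → Any (λ x → 0 < f x) xs → 0 < sum (map f xs)
sum-positive f {x ∷ xs} (here 0<fx)  = <-≤-trans 0<fx (m≤m+n (f x) _)
sum-positive f {x ∷ xs} (there pos) = <-≤-trans (sum-positive f pos) (m≤n+m _ (f x))

-- Summands are natural numbers, so nothing cancels and one positive summand suffices. The
-- enumeration contains `σ` only up to `≈`, hence the transport to a listed `τ`.
per-positive : (M : Matrix n) (σ : Permutation′ n) →
               (∀ i → NonZero (M i (σ ⟨$⟩ʳ i))) → 0 < per M
per-positive M σ nz = sum-positive _ (Any.map (λ {τ} → positive τ) (permutations-complete σ))
  where
  positive : ∀ τ → σ ≈ τ → 0 < product (tabulate λ i → M i (τ ⟨$⟩ʳ i))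
  positive τ σ≈τ = >-nonZero⁻¹ _ {{product≢0 (tabulate⁺ λ i →
    subst (λ j → NonZero (M i j)) (σ≈τ i) (nz i))}}

indicator-nonZero : ∀ a b c → LcmCondition a b c →
                    NonZero (if does (lcmCondition? a b c) then 1 else 0)
-- After the rewrite the conditional reduces to 1, whose `NonZero` proof is found by eta.
indicator-nonZero a b c cond rewrite dec-true (lcmCondition? a b c) cond = _

module _ {π : Permutation′ n} {i : Fin n} {k : ℕ} (isLength : IsCycleLength π i k) where
  open IsCycleLength isLength

  fold-multiple : ∀ q → fold i (π ⟨$⟩ʳ_) (q * k) ≡ i
  fold-multiple zero    = refl
  fold-multiple (suc q) = begin
    fold i πᶠ (suc q * k)           ≡⟨ fold-+ i πᶠ k ⟩
    fold (fold i πᶠ (q * k)) πᶠ k   ≡⟨ cong (λ j → fold j πᶠ k) (fold-multiple q) ⟩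
    fold i πᶠ k                     ≡⟨ returns ⟩
    i                               ∎
    where
    open ≡-Reasoning
    πᶠ = π ⟨$⟩ʳ_

  length∣⇒returns : ∀ {m} → k ∣ m → fold i (π ⟨$⟩ʳ_) m ≡ i
  length∣⇒returns (divides-refl q) = fold-multiple q

  -- Dropping whole turns of the cycle shows that `m % k` steps also return to `i`. As `m % k < k`,
  -- a nonzero remainder would contradict minimality.
  returns⇒length∣ : ∀ {m} → fold i (π ⟨$⟩ʳ_) m ≡ i → k ∣ m
  returns⇒length∣ {m} ret = m%n≡0⇒n∣m m k (decidable-stable (m % k ℕ.≟ 0) λ m%k≢0 →
    minimal (n≢0⇒n>0 m%k≢0) (m%n<n m k) remainder-returns)
    where
    open ≡-Reasoning
    πᶠ = π ⟨$⟩ʳ_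

    instance
      k≢0 : NonZero k
      k≢0 = >-nonZero positive

    remainder-returns : fold i πᶠ (m % k) ≡ i
    remainder-returns = begin
      fold i πᶠ (m % k)                         ≡⟨ cong (λ j → fold j πᶠ (m % k)) (fold-multiple (m / k)) ⟨
      fold (fold i πᶠ (m / k * k)) πᶠ (m % k)   ≡⟨ fold-+ i πᶠ (m % k) ⟨
      fold i πᶠ (m % k + m / k * k)             ≡⟨ cong (fold i πᶠ) (m≡m%n+[m/n]*n m k) ⟨
      fold i πᶠ m                               ≡⟨ ret ⟩
      i                                         ∎

-- Each hypothesis says that adjoining the third number does not enlarge the lcm of the other two,
-- so all the lcms in the condition agree.
∣lcm⇒lcmCondition : ∀ {a b c} → a ∣ lcm b c → b ∣ lcm a c → c ∣ lcm a b → LcmCondition a b c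
∣lcm⇒lcmCondition {a} {b} {c} a∣bc b∣ac c∣ab =
    ∣-antisym (lcm-least a∣bc (m∣lcm[m,n] b c)) (lcm-least (n∣lcm[m,n] a b) c∣ab)
  , ∣-antisym (lcm-least b∣ac (n∣lcm[m,n] a c)) (lcm-least a∣bc (n∣lcm[m,n] b c))
  , ∣-antisym
      (lcm-least (∣-trans (m∣lcm[m,n] a b) (m∣lcm[m,n] (lcm a b) c)) (n∣lcm[m,n] (lcm a b) c))
      (lcm-least (lcm-least (m∣lcm[m,n] a c) b∣ac) (n∣lcm[m,n] a c))

module _ {L : Square n} (latin : IsLatinSquare L)
         (α β γ : Permutation′ n) (autotopism : IsAutotopism L (α , β , γ)) where
  open IsLatinSquare latin
  open ≡-Reasoning

  fold-autotopism : ∀ i j m → fold (L i j) (γ ⟨$⟩ʳ_) m ≡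
                              L (fold i (α ⟨$⟩ʳ_) m) (fold j (β ⟨$⟩ʳ_) m)
  fold-autotopism i j zero    = refl
  fold-autotopism i j (suc m) =
    trans (cong (γ ⟨$⟩ʳ_) (fold-autotopism i j m)) (autotopism _ _)

  -- Take the lcm of two lengths as exponent: two of row, column and symbol return, so the third
  -- does too, and its length divides that lcm.
  cell-lcmCondition : ∀ {i j a b c} → IsCycleLength α i a → IsCycleLength β j b →
                      IsCycleLength γ (L i j) c → LcmCondition a b c
  cell-lcmCondition {i} {j} {a} {b} {c} a-length b-length c-length = ∣lcm⇒lcmCondition
    -- Column and symbol are back after `b∨c` steps; a symbol occurs in column `j` in only one row,
    -- so the row is back as well.
    (returns⇒length∣ a-length (column-distinct j (begin
      L (αᵐ b∨c) j          ≡⟨ cong (L _) (length∣⇒returns b-length (m∣lcm[m,n] b c)) ⟨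
      L (αᵐ b∨c) (βᵐ b∨c)   ≡⟨ fold-autotopism i j b∨c ⟨
      γᵐ b∨c                ≡⟨ length∣⇒returns c-length (n∣lcm[m,n] b c) ⟩
      L i j                 ∎)))
    (returns⇒length∣ b-length (row-distinct i (begin
      L i (βᵐ a∨c)          ≡⟨ cong (λ i′ → L i′ _) (length∣⇒returns a-length (m∣lcm[m,n] a c)) ⟨
      L (αᵐ a∨c) (βᵐ a∨c)   ≡⟨ fold-autotopism i j a∨c ⟨
      γᵐ a∨c                ≡⟨ length∣⇒returns c-length (n∣lcm[m,n] a c) ⟩
      L i j                 ∎)))
    (returns⇒length∣ c-length (begin
      γᵐ a∨b                ≡⟨ fold-autotopism i j a∨b ⟩
      L (αᵐ a∨b) (βᵐ a∨b)   ≡⟨ cong₂ L (length∣⇒returns a-length (m∣lcm[m,n] a b))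
                                       (length∣⇒returns b-length (n∣lcm[m,n] a b)) ⟩
      L i j                 ∎))
    where
    a∨b = lcm a b
    a∨c = lcm a c
    b∨c = lcm b c
    αᵐ = fold i (α ⟨$⟩ʳ_)
    βᵐ = fold j (β ⟨$⟩ʳ_)
    γᵐ = fold (L i j) (γ ⟨$⟩ʳ_)

  X-nonZero : ∀ i j → NonZero (X (α , β , γ) (L i j) i j)
  X-nonZero i j = indicator-nonZero (cycleLength α i) (cycleLength β j) (cycleLength γ (L i j))
    (cell-lcmCondition (proj₂ (cycle-length α i)) (proj₂ (cycle-length β j))
                       (proj₂ (cycle-length γ (L i j))))

module _ {L : Square n} (latin : IsLatinSquare L) (s : Fin n) where
  open IsLatinSquare latin

  symbolColumn : Fin n → Fin n
  symbolColumn i = proj₁ (injective⇒surjective (row-distinct i) s)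

  L-symbolColumn : ∀ i → L i (symbolColumn i) ≡ s
  L-symbolColumn i = proj₂ (injective⇒surjective (row-distinct i) s)

  -- Two rows sharing this column would put `s` into it twice.
  symbolColumn-injective : Injective _≡_ _≡_ symbolColumn
  symbolColumn-injective {i} {i′} eq = column-distinct (symbolColumn i) (trans (L-symbolColumn i)
    (trans (sym (L-symbolColumn i′)) (cong (L i′) (sym eq))))

  symbolPermutation : Permutation′ n
  symbolPermutation = injective⇒permutation symbolColumn symbolColumn-injective

lemma3p8 : ∀ (n : ℕ) (θ : Triple n) → Atp n θ → ∀ (s : Fin n) → 0 < per (X θ s)
lemma3p8 n θ@(α , β , γ) (L , latin , autotopism) s =
  per-positive (X θ s) (symbolPermutation latin s) λ i →
    -- `X-nonZero` concerns the symbol found in the cell; along the chosen permutation that symbol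
    -- is always `s`.
    subst (λ t → NonZero (X θ t i (symbolColumn latin s i))) (L-symbolColumn latin s i)
      (X-nonZero latin α β γ autotopism i (symbolColumn latin s i))
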